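{- Let $G=(V,E,w)$ be a finite connected graph with $|V|=n\ge 2$ and weights $w:E\to\mathbb{R}_{>0}$, and let $d_G$ be its unit-length shortest-path metric. Let $u$ be an ultrametric on $V$ satisfying $u(x,y)\ge d_G(x,y)$ for all $x,y\in V$. Then there exists a rooted binary hierarchical tree $T$ on $V$ such that: (1) every cluster of $T$ induces a connected subgraph of $G$; (2) $u_T^{\mathrm{diam}}$ is an ultrametric dominating $d_G$, i.e. $u_T^{\mathrm{diam}}(x,y)\ge d_G(x,y)$ for all $x,y\in V$; (3) for every edge $xy\in E$, $u_T^{\mathrm{diam}}(x,y)\le u(x,y)$. Consequently, $$\sum_{xy\in E}w_{xy}\,u_T^{\mathrm{diam}}(x,y)\le\sum_{xy\in E}w_{xy}\,u(x,y).$$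
   Context: $d_G$ is the shortest-path metric of the support graph $(V,E)$ with every edge of length $1$; the weights $w$ are not edge lengths. An ultrametric on $V$ is a metric $u:V\times V\to\mathbb{R}_{\ge0}$ with $u(x,y)\le\max\{u(x,z),u(z,y)\}$ for all $x,y,z\in V$. A hierarchical tree $T$ on $V$ is a rooted tree whose leaves are the vertices of $V$; it is binary if every internal node has exactly two children. Every node is identified with the set of leaves in its subtree, called a cluster. For $x,y\in V$, $C_T(x,y)$ is the cluster of the lowest common ancestor of $x$ and $y$. For $S\subseteq V$, $\operatorname{diam}_{d_G}(S)=\max_{a,b\in S}d_G(a,b)$. The diameter labeling is $u_T^{\mathrm{diam}}(x,x)=0$ and $u_T^{\mathrm{diam}}(x,y)=\operatorname{diam}_{d_G}(C_T(x,y))$ for $x\ne y$. -}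

module Defs where

open import Data.Bool.Base using (if_then_else_)
open import Data.Fin.Base as Fin using (Fin)
open import Data.Fin.Properties as Fin using (any?)
open import Data.Fin.Subset using (Subset; _∈_; _∪_; ⁅_⁆)
open import Data.Fin.Subset.Properties using (_∈?_)
import Data.Integer.Base as ℤ
open import Data.List.Base
  using (List; []; _∷_; _++_; map; foldr; filter; allFin; cartesianProduct; cartesianProductWith)
import Data.List.Extrema.Nat as Max
open import Data.List.Relation.Binary.Permutation.Propositional using (_↭_)
open import Data.Nat.Base as ℕ using (ℕ; zero; suc; _≤_)
import Data.Nat.Properties as ℕ
open import Data.Product.Base using (Σ; _×_; _,_; proj₁; proj₂; ∃; ∃-syntax)
open import Data.Rational.Base as ℚ using (ℚ; 0ℚ; 1ℚ; ½; ∣_∣)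
import Data.Rational.Properties as ℚ
open import Data.Rational.Solver using (module +-*-Solver)
open import Data.Sum.Base using (inj₁; inj₂)
open import Data.Tree.Binary using (Tree; leaf; node; module Leaves)
open import Data.Unit.Base using (⊤)
open import Function.Base using (_on_)
import Function.Metric.Structures as Metric
open import Level using (0ℓ)
open import Relation.Binary.Core using (Rel)
open import Relation.Binary.Definitions using (Decidable)
open import Relation.Binary.PropositionalEquality using (_≡_; refl; sym; cong; cong₂; subst)
open import Relation.Nullary using (¬_; yes; no; contradiction)
open import Relation.Nullary.Decidable using (⌊_⌋; _×-dec_)
import Relation.Unary as Unary

-- The real numbers are the setoid of Cauchy sequences of rationals modulo
-- _≈ℝ_.  Under excluded middle the order _≤ℝ_ is total, as usual for ℝ.

Eventually : (ℕ → Set) → Set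
Eventually P = ∃[ N ] ∀ n → N ≤ n → P n

IsCauchy : (ℕ → ℚ) → Set
IsCauchy s = ∀ ε → 0ℚ ℚ.< ε →
  ∃[ N ] ∀ m n → N ≤ m → N ≤ n → ∣ s m ℚ.- s n ∣ ℚ.< ε

record ℝ : Set where
  constructor mkℝ
  field
    seq    : ℕ → ℚ
    cauchy : IsCauchy seq

open ℝ public

infix  4 _≈ℝ_ _≤ℝ_ _<ℝ_
infixl 6 _+ℝ_ _⊔ℝ_
infixl 7 _*ℝ_

_≈ℝ_ : Rel ℝ 0ℓ
x ≈ℝ y = ∀ ε → 0ℚ ℚ.< ε → Eventually λ n → ∣ seq x n ℚ.- seq y n ∣ ℚ.< ε

_≤ℝ_ : Rel ℝ 0ℓ
x ≤ℝ y = ∀ ε → 0ℚ ℚ.< ε → Eventually λ n → seq x n ℚ.≤ seq y n ℚ.+ ε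

_<ℝ_ : Rel ℝ 0ℓ
x <ℝ y = ∃[ ε ] 0ℚ ℚ.< ε × Eventually λ n → seq x n ℚ.+ ε ℚ.≤ seq y n

module Estimates where
  open ℚ.≤-Reasoning

  p≤∣p∣ : ∀ p → p ℚ.≤ ∣ p ∣
  p≤∣p∣ p with ℚ.≤-total 0ℚ p
  ... | inj₁ 0≤p = ℚ.≤-reflexive (sym (ℚ.0≤p⇒∣p∣≡p 0≤p))
  ... | inj₂ p≤0 = ℚ.≤-trans p≤0 (ℚ.0≤∣p∣ p)

  ∣-∣<⇒< : ∀ p q {ε} → ∣ p ℚ.- q ∣ ℚ.< ε → p ℚ.< q ℚ.+ ε
  ∣-∣<⇒< p q {ε} h = begin-strict
    p                      ≡⟨ solve 2 (λ p q → p := q :+ (p :- q)) refl p q ⟩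
    q ℚ.+ (p ℚ.- q)        ≤⟨ ℚ.+-monoʳ-≤ q (p≤∣p∣ (p ℚ.- q)) ⟩
    q ℚ.+ ∣ p ℚ.- q ∣      <⟨ ℚ.+-monoʳ-< q h ⟩
    q ℚ.+ ε                ∎
    where open +-*-Solver

  <⇒-< : ∀ p q {ε} → p ℚ.< q ℚ.+ ε → p ℚ.- q ℚ.< ε
  <⇒-< p q {ε} h = begin-strict
    p ℚ.- q           <⟨ ℚ.+-monoˡ-< (ℚ.- q) h ⟩
    q ℚ.+ ε ℚ.- q     ≡⟨ solve 2 (λ q ε → q :+ ε :- q := ε) refl q ε ⟩
    ε                 ∎
    where open +-*-Solver

  <⇒∣-∣< : ∀ p q {ε} → p ℚ.< q ℚ.+ ε → q ℚ.< p ℚ.+ ε → ∣ p ℚ.- q ∣ ℚ.< ε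
  <⇒∣-∣< p q {ε} h k with ℚ.∣p∣≡p∨∣p∣≡-p (p ℚ.- q)
  ... | inj₁ e = subst (ℚ._< ε) (sym e) (<⇒-< p q h)
  ... | inj₂ e = begin-strict
    ∣ p ℚ.- q ∣        ≡⟨ e ⟩
    ℚ.- (p ℚ.- q)      ≡⟨ solve 2 (λ p q → :- (p :- q) := q :- p) refl p q ⟩
    q ℚ.- p            <⟨ <⇒-< q p k ⟩
    ε                  ∎
    where open +-*-Solver

  ½+½ : ∀ ε → ½ ℚ.* ε ℚ.+ ½ ℚ.* ε ≡ ε
  ½+½ ε = begin-equality
    ½ ℚ.* ε ℚ.+ ½ ℚ.* ε   ≡⟨ sym (ℚ.*-distribʳ-+ ε ½ ½) ⟩
    1ℚ ℚ.* ε              ≡⟨ ℚ.*-identityˡ ε ⟩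
    ε                     ∎

  0<* : ∀ p {q} .{{_ : ℚ.Positive p}} → 0ℚ ℚ.< q → 0ℚ ℚ.< p ℚ.* q
  0<* p {q} 0<q = subst (ℚ._< p ℚ.* q) (ℚ.*-zeroʳ p) (ℚ.*-monoʳ-<-pos p 0<q)

  0<½* : ∀ {ε} → 0ℚ ℚ.< ε → 0ℚ ℚ.< ½ ℚ.* ε
  0<½* = 0<* ½

  ⊔-<+ : ∀ a b c d {ε} → a ℚ.< c ℚ.+ ε → b ℚ.< d ℚ.+ ε → a ℚ.⊔ b ℚ.< c ℚ.⊔ d ℚ.+ ε
  ⊔-<+ a b c d {ε} h k with ℚ.⊔-sel a b
  ... | inj₁ e = subst (ℚ._< c ℚ.⊔ d ℚ.+ ε) (sym e) (ℚ.<-≤-trans h (ℚ.+-monoˡ-≤ ε (ℚ.p≤p⊔q c d)))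
  ... | inj₂ e = subst (ℚ._< c ℚ.⊔ d ℚ.+ ε) (sym e) (ℚ.<-≤-trans k (ℚ.+-monoˡ-≤ ε (ℚ.p≤q⊔p c d)))

  const-cauchy : ∀ q → IsCauchy (λ _ → q)
  const-cauchy q ε 0<ε = 0 , λ _ _ _ _ → subst (ℚ._< ε) (sym (cong ∣_∣ (ℚ.+-inverseʳ q))) 0<ε

  +-cauchy : ∀ s t → IsCauchy s → IsCauchy t → IsCauchy (λ n → s n ℚ.+ t n)
  +-cauchy s t cs ct ε 0<ε
    with M , hs ← cs (½ ℚ.* ε) (0<½* 0<ε) | N , ht ← ct (½ ℚ.* ε) (0<½* 0<ε)
    = M ℕ.⊔ N , λ m n p q → begin-strict
      ∣ s m ℚ.+ t m ℚ.- (s n ℚ.+ t n) ∣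
        ≡⟨ cong ∣_∣ (solve 4 (λ a b c d → a :+ b :- (c :+ d) := (a :- c) :+ (b :- d)) refl
             (s m) (t m) (s n) (t n)) ⟩
      ∣ (s m ℚ.- s n) ℚ.+ (t m ℚ.- t n) ∣
        ≤⟨ ℚ.∣p+q∣≤∣p∣+∣q∣ (s m ℚ.- s n) (t m ℚ.- t n) ⟩
      ∣ s m ℚ.- s n ∣ ℚ.+ ∣ t m ℚ.- t n ∣
        <⟨ ℚ.+-mono-< (hs m n (ℕ.m⊔n≤o⇒m≤o M N p) (ℕ.m⊔n≤o⇒m≤o M N q))
                      (ht m n (ℕ.m⊔n≤o⇒n≤o M N p) (ℕ.m⊔n≤o⇒n≤o M N q)) ⟩
      ½ ℚ.* ε ℚ.+ ½ ℚ.* ε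
        ≡⟨ ½+½ ε ⟩
      ε ∎
    where open +-*-Solver

  ⊔-cauchy : ∀ s t → IsCauchy s → IsCauchy t → IsCauchy (λ n → s n ℚ.⊔ t n)
  ⊔-cauchy s t cs ct ε 0<ε with M , hs ← cs ε 0<ε | N , ht ← ct ε 0<ε
    = M ℕ.⊔ N , λ m n p q →
        let p₁ = ℕ.m⊔n≤o⇒m≤o M N p ; q₁ = ℕ.m⊔n≤o⇒m≤o M N q
            p₂ = ℕ.m⊔n≤o⇒n≤o M N p ; q₂ = ℕ.m⊔n≤o⇒n≤o M N q
        in <⇒∣-∣< (s m ℚ.⊔ t m) (s n ℚ.⊔ t n)
             (⊔-<+ (s m) (t m) (s n) (t n)
               (∣-∣<⇒< (s m) (s n) (hs m n p₁ q₁)) (∣-∣<⇒< (t m) (t n) (ht m n p₂ q₂)))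
             (⊔-<+ (s n) (t n) (s m) (t m)
               (∣-∣<⇒< (s n) (s m) (hs n m q₁ p₁)) (∣-∣<⇒< (t n) (t m) (ht n m q₂ p₂)))

  eventually-bounded : ∀ {s} → IsCauchy s →
    ∃[ B ] 0ℚ ℚ.< B × Eventually λ n → ∣ s n ∣ ℚ.≤ B
  eventually-bounded {s} cs with N , h ← cs 1ℚ (ℚ.positive⁻¹ 1ℚ)
    = ∣ s N ∣ ℚ.+ 1ℚ
    , ℚ.+-mono-≤-< (ℚ.0≤∣p∣ (s N)) (ℚ.positive⁻¹ 1ℚ)
    , N , λ n p → begin
        ∣ s n ∣
          ≡⟨ cong ∣_∣ (solve 2 (λ a b → a := b :+ (a :- b)) refl (s n) (s N)) ⟩
        ∣ s N ℚ.+ (s n ℚ.- s N) ∣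
          ≤⟨ ℚ.∣p+q∣≤∣p∣+∣q∣ (s N) (s n ℚ.- s N) ⟩
        ∣ s N ∣ ℚ.+ ∣ s n ℚ.- s N ∣
          ≤⟨ ℚ.+-monoʳ-≤ ∣ s N ∣ (ℚ.<⇒≤ (h n N p ℕ.≤-refl)) ⟩
        ∣ s N ∣ ℚ.+ 1ℚ ∎
    where open +-*-Solver

  -- For B > 0 and ε > 0 some δ > 0 has B δ = ε / 2.
  half-quotient : ∀ {B ε} → 0ℚ ℚ.< B → 0ℚ ℚ.< ε → ∃[ δ ] 0ℚ ℚ.< δ × B ℚ.* δ ≡ ½ ℚ.* ε
  half-quotient {B} {ε} 0<B 0<ε = B⁻¹ ℚ.* (½ ℚ.* ε) , 0<δ , Bδ≡
    where
    instance
      B-pos = ℚ.positive 0<B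
      B≢0   = ℚ.pos⇒nonZero B
    B⁻¹ = ℚ.1/ B
    instance
      B⁻¹-pos = ℚ.1/pos⇒pos B
    0<δ : 0ℚ ℚ.< B⁻¹ ℚ.* (½ ℚ.* ε)
    0<δ = 0<* B⁻¹ (0<½* 0<ε)
    Bδ≡ : B ℚ.* (B⁻¹ ℚ.* (½ ℚ.* ε)) ≡ ½ ℚ.* ε
    Bδ≡ = begin-equality
      B ℚ.* (B⁻¹ ℚ.* (½ ℚ.* ε))   ≡⟨ sym (ℚ.*-assoc B B⁻¹ (½ ℚ.* ε)) ⟩
      B ℚ.* B⁻¹ ℚ.* (½ ℚ.* ε)     ≡⟨ cong (ℚ._* (½ ℚ.* ε)) (ℚ.*-inverseʳ B) ⟩
      1ℚ ℚ.* (½ ℚ.* ε)            ≡⟨ ℚ.*-identityˡ (½ ℚ.* ε) ⟩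
      ½ ℚ.* ε                     ∎

  ∣*∣< : ∀ {B δ} p q → 0ℚ ℚ.< B → ∣ p ∣ ℚ.≤ B → ∣ q ∣ ℚ.< δ → ∣ p ℚ.* q ∣ ℚ.< B ℚ.* δ
  ∣*∣< {B} {δ} p q 0<B p≤B q<δ = begin-strict
    ∣ p ℚ.* q ∣         ≡⟨ ℚ.∣p*q∣≡∣p∣*∣q∣ p q ⟩
    ∣ p ∣ ℚ.* ∣ q ∣     ≤⟨ ℚ.*-monoʳ-≤-nonNeg ∣ q ∣ {{ℚ.∣-∣-nonNeg q}} p≤B ⟩
    B ℚ.* ∣ q ∣         <⟨ ℚ.*-monoʳ-<-pos B {{ℚ.positive 0<B}} q<δ ⟩
    B ℚ.* δ             ∎

  *-close : ∀ {A B α β ε} a b c d → 0ℚ ℚ.< A → 0ℚ ℚ.< B →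
    A ℚ.* α ≡ ½ ℚ.* ε → B ℚ.* β ≡ ½ ℚ.* ε →
    ∣ a ∣ ℚ.≤ A → ∣ b ℚ.- d ∣ ℚ.< α → ∣ d ∣ ℚ.≤ B → ∣ a ℚ.- c ∣ ℚ.< β →
    ∣ a ℚ.* b ℚ.- c ℚ.* d ∣ ℚ.< ε
  *-close {A} {B} {α} {β} {ε} a b c d 0<A 0<B Aα≡ Bβ≡ a≤A bd<α d≤B ac<β = begin-strict
    ∣ a ℚ.* b ℚ.- c ℚ.* d ∣
      ≡⟨ cong ∣_∣ (solve 4 (λ a b c d → a :* b :- c :* d := a :* (b :- d) :+ d :* (a :- c))
           refl a b c d) ⟩
    ∣ a ℚ.* (b ℚ.- d) ℚ.+ d ℚ.* (a ℚ.- c) ∣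
      ≤⟨ ℚ.∣p+q∣≤∣p∣+∣q∣ (a ℚ.* (b ℚ.- d)) (d ℚ.* (a ℚ.- c)) ⟩
    ∣ a ℚ.* (b ℚ.- d) ∣ ℚ.+ ∣ d ℚ.* (a ℚ.- c) ∣
      <⟨ ℚ.+-mono-< (∣*∣< a (b ℚ.- d) 0<A a≤A bd<α) (∣*∣< d (a ℚ.- c) 0<B d≤B ac<β) ⟩
    A ℚ.* α ℚ.+ B ℚ.* β
      ≡⟨ cong₂ ℚ._+_ Aα≡ Bβ≡ ⟩
    ½ ℚ.* ε ℚ.+ ½ ℚ.* ε
      ≡⟨ ½+½ ε ⟩
    ε ∎
    where open +-*-Solver

  *-cauchy : ∀ s t → IsCauchy s → IsCauchy t → IsCauchy (λ n → s n ℚ.* t n)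
  *-cauchy s t cs ct ε 0<ε = bounds (eventually-bounded cs) (eventually-bounded ct)
    where
    Goal = ∃[ N ] ∀ m n → N ≤ m → N ≤ n → ∣ s m ℚ.* t m ℚ.- s n ℚ.* t n ∣ ℚ.< ε

    quotients : ∀ {A B} → 0ℚ ℚ.< A → 0ℚ ℚ.< B →
      (Eventually λ n → ∣ s n ∣ ℚ.≤ A) → (Eventually λ n → ∣ t n ∣ ℚ.≤ B) →
      ∃[ α ] 0ℚ ℚ.< α × A ℚ.* α ≡ ½ ℚ.* ε → ∃[ β ] 0ℚ ℚ.< β × B ℚ.* β ≡ ½ ℚ.* ε → Goal
    quotients 0<A 0<B (K , s≤A) (L , t≤B) (α , 0<α , Aα≡) (β , 0<β , Bβ≡)
      with M , ht ← ct α 0<α | N , hs ← cs β 0<β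
      = (K ℕ.⊔ L) ℕ.⊔ (M ℕ.⊔ N) , λ m n p q →
          let pK = ℕ.m⊔n≤o⇒m≤o K L (ℕ.m⊔n≤o⇒m≤o (K ℕ.⊔ L) (M ℕ.⊔ N) p)
              qL = ℕ.m⊔n≤o⇒n≤o K L (ℕ.m⊔n≤o⇒m≤o (K ℕ.⊔ L) (M ℕ.⊔ N) q)
              p′ = ℕ.m⊔n≤o⇒n≤o (K ℕ.⊔ L) (M ℕ.⊔ N) p
              q′ = ℕ.m⊔n≤o⇒n≤o (K ℕ.⊔ L) (M ℕ.⊔ N) q
          in *-close (s m) (t m) (s n) (t n) 0<A 0<B Aα≡ Bβ≡
               (s≤A m pK) (ht m n (ℕ.m⊔n≤o⇒m≤o M N p′) (ℕ.m⊔n≤o⇒m≤o M N q′))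
               (t≤B n qL) (hs m n (ℕ.m⊔n≤o⇒n≤o M N p′) (ℕ.m⊔n≤o⇒n≤o M N q′))

    bounds : ∃[ A ] 0ℚ ℚ.< A × (Eventually λ n → ∣ s n ∣ ℚ.≤ A) →
             ∃[ B ] 0ℚ ℚ.< B × (Eventually λ n → ∣ t n ∣ ℚ.≤ B) → Goal
    bounds (A , 0<A , s≤A) (B , 0<B , t≤B) =
      quotients 0<A 0<B s≤A t≤B (half-quotient 0<A 0<ε) (half-quotient 0<B 0<ε)

open Estimates

fromℚ : ℚ → ℝ
fromℚ q = mkℝ (λ _ → q) (const-cauchy q)

fromℕ : ℕ → ℝ
fromℕ k = fromℚ (ℤ.+ k ℚ./ 1)

0ℝ : ℝ
0ℝ = fromℚ 0ℚ

_+ℝ_ _*ℝ_ _⊔ℝ_ : ℝ → ℝ → ℝ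
x +ℝ y = mkℝ (λ n → seq x n ℚ.+ seq y n) (+-cauchy (seq x) (seq y) (cauchy x) (cauchy y))
x *ℝ y = mkℝ (λ n → seq x n ℚ.* seq y n) (*-cauchy (seq x) (seq y) (cauchy x) (cauchy y))
x ⊔ℝ y = mkℝ (λ n → seq x n ℚ.⊔ seq y n) (⊔-cauchy (seq x) (seq y) (cauchy x) (cauchy y))

sumℝ : List ℝ → ℝ
sumℝ = foldr _+ℝ_ 0ℝ

-- The ordinary triangle inequality is implied by the strong one,
-- since distances are nonnegative.
IsUltrametric : {A : Set} → (A → A → ℝ) → Set
IsUltrametric u = Metric.IsGeneralMetric _≡_ _≈ℝ_ _≤ℝ_ 0ℝ _⊔ℝ_ u

Walk : {A : Set} → Rel A 0ℓ → ℕ → Rel A 0ℓ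
Walk R zero    x y = x ≡ y
Walk R (suc k) x y = ∃[ z ] R x z × Walk R k z y

Connected : {A : Set} → Rel A 0ℓ → Set
Connected R = ∀ x y → ∃[ k ] Walk R k x y

walk? : ∀ {n} {R : Rel (Fin n) 0ℓ} → Decidable R → ∀ k → Decidable (Walk R k)
walk? R? zero    x y = x Fin.≟ y
walk? R? (suc k) x y = any? λ z → R? x z ×-dec walk? R? k z y

least : {P : ℕ → Set} → Unary.Decidable P → ∃ P → ∃[ m ] P m × (∀ j → P j → m ≤ j)
least P? (k , pk) = go k P? pk
  where
  go : ∀ {P : ℕ → Set} k → Unary.Decidable P → P k → ∃[ m ] P m × (∀ j → P j → m ≤ j)
  go k P? pk with P? 0
  ... | yes p0 = 0 , p0 , λ _ _ → ℕ.z≤n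
  go zero    P? pk | no ¬p0 = contradiction pk ¬p0
  go {P} (suc k) P? pk | no ¬p0 with m , pm , min ← go {λ j → P (suc j)} k (λ j → P? (suc j)) pk
    = suc m , pm , λ { zero p0 → contradiction p0 ¬p0 ; (suc j) pj → ℕ.s≤s (min j pj) }

record WeightedGraph (n : ℕ) : Set₁ where
  field
    Adj        : Rel (Fin n) 0ℓ
    adj?       : Decidable Adj
    adj-sym    : ∀ {x y} → Adj x y → Adj y x
    adj-irrefl : ∀ {x} → ¬ Adj x x
    -- The values of weight at non-adjacent pairs are never used.
    weight     : Fin n → Fin n → ℝ
    weight-sym : ∀ {x y} → Adj x y → weight x y ≈ℝ weight y x
    weight-pos : ∀ {x y} → Adj x y → 0ℝ <ℝ weight x y

module _ {n : ℕ} (G : WeightedGraph n) where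
  open WeightedGraph G

  InducedAdj : (S : Subset n) → Rel (Σ (Fin n) (_∈ S)) 0ℓ
  InducedAdj S = Adj on proj₁

  -- Each undirected edge is listed once, as (x , y) with x < y.
  edges : List (Fin n × Fin n)
  edges = filter (λ (x , y) → (x Fin.<? y) ×-dec adj? x y)
                 (cartesianProduct (allFin n) (allFin n))

  weightedSum : (Fin n → Fin n → ℝ) → ℝ
  weightedSum f = sumℝ (map (λ (x , y) → weight x y *ℝ f x y) edges)

  module _ (connected : Connected Adj) where

    dist : Fin n → Fin n → ℕ
    dist x y = proj₁ (least (λ k → walk? adj? k x y) (connected x y))

    Dominates : (Fin n → Fin n → ℝ) → Set
    Dominates u = ∀ x y → fromℕ (dist x y) ≤ℝ u x y

BinaryTree : ℕ → Set
BinaryTree n = Tree ⊤ (Fin n)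

IsHierarchical : ∀ {n} → BinaryTree n → Set
IsHierarchical {n} T = Leaves.toList T ↭ allFin n

cluster : ∀ {n} → BinaryTree n → Subset n
cluster (leaf x)     = ⁅ x ⁆
cluster (node l _ r) = cluster l ∪ cluster r

clusters : ∀ {n} → BinaryTree n → List (Subset n)
clusters T@(leaf _)     = cluster T ∷ []
clusters T@(node l _ r) = cluster T ∷ clusters l ++ clusters r

-- The cluster of the lowest common ancestor, when x and y are leaves of
-- the tree and leaves are pairwise distinct.
lcaCluster : ∀ {n} → BinaryTree n → Fin n → Fin n → Subset n
lcaCluster T@(leaf _)     x y = cluster T
lcaCluster T@(node l _ r) x y =
  if ⌊ (x ∈? cluster l) ×-dec (y ∈? cluster l) ⌋ then lcaCluster l x y
  else if ⌊ (x ∈? cluster r) ×-dec (y ∈? cluster r) ⌋ then lcaCluster r x y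
  else cluster T

diam : ∀ {n} → (Fin n → Fin n → ℕ) → Subset n → ℕ
diam {n} d S = Max.max 0 (cartesianProductWith d members members)
  where
  members : List (Fin n)
  members = filter (_∈? S) (allFin n)

diamLabel : ∀ {n} → (Fin n → Fin n → ℕ) → BinaryTree n → Fin n → Fin n → ℝ
diamLabel d T x y = fromℕ (if ⌊ x Fin.≟ y ⌋ then 0 else diam d (lcaCluster T x y))

{-# OPTIONS --safe #-}

-- Single-linkage clustering: start from the singletons and repeatedly join the
-- two trees linked by an edge xy minimising u among the edges that run between
-- different trees.  Earlier joins used edges of no larger u, so by the strong
-- triangle inequality all u-distances inside the new cluster, and hence its
-- d_G-diameter, are at most u(x,y); and every edge whose endpoints first meet in
-- this cluster was still available, so its u is at least u(x,y).
-- That the diameter labeling is an ultrametric only uses that clusters are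
-- laminar: C(x,y) and C(y,z) share y, hence are nested, and the larger one
-- contains C(x,z).

module Submission where

open import Defs
open Estimates
open import Axiom.ExcludedMiddle using (ExcludedMiddle)
open import Data.Bool.Base using (if_then_else_)
open import Data.Empty using (⊥)
open import Data.Fin.Base using (Fin)
import Data.Fin.Properties as Fin
open import Data.Fin.Subset using (Subset; _∈_; _∉_; _⊆_; _∪_; ⁅_⁆)
open import Data.Fin.Subset.Properties
  using (_∈?_; x∈⁅x⁆; x∈⁅y⁆⇒x≡y; x∈p∪q⁺; x∈p∪q⁻; p⊆p∪q; q⊆p∪q)
import Data.Integer.Base as ℤ
import Data.Integer.Properties as ℤ
open import Data.List.Base
  using (List; []; _∷_; [_]; _++_; map; concat; concatMap; filter; length; allFin; cartesianProduct)
import Data.List.Extrema as Extrema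
import Data.List.Extrema.Nat as Max
open import Data.List.Membership.Propositional using () renaming (_∈_ to _∈ˡ_)
open import Data.List.Membership.Propositional.Properties
  using (∈-allFin; ∈-filter⁺; ∈-filter⁻; ∈-++⁺ˡ; ∈-++⁺ʳ; ∈-++⁻; ∈-concatMap⁺; ∈-concatMap⁻;
         ∈-cartesianProduct⁺; ∈-cartesianProductWith⁺; ∈-cartesianProductWith⁻)
import Data.List.Properties as List
open import Data.List.Relation.Binary.Permutation.Propositional
  using (_↭_; prep; swap; ↭-reflexive; ↭-refl; ↭-sym; ↭-trans; ↭⇒↭ₛ)
open import Data.List.Relation.Binary.Permutation.Propositional.Properties
  using (All-resp-↭; Any-resp-↭; ∈-resp-↭; ↭-length; ++⁺ˡ; shifts)
import Data.List.Relation.Binary.Permutation.Setoid.Properties as Permutationₛ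
open import Data.List.Relation.Unary.All as All using (All; []; _∷_)
import Data.List.Relation.Unary.All.Properties as All
open import Data.List.Relation.Unary.AllPairs using ([]; _∷_)
open import Data.List.Relation.Unary.Any as Any using (Any; here; there)
open import Data.List.Relation.Unary.Unique.Propositional using (Unique)
open import Data.List.Relation.Unary.Unique.Propositional.Properties using (allFin⁺)
open import Data.Nat.Base as ℕ using (ℕ; zero; suc; _≤_; z≤n; s≤s)
import Data.Nat.Properties as ℕ
open import Data.Product.Base using (_×_; _,_; proj₁; proj₂; ∃; ∃₂; ∃-syntax; uncurry)
open import Data.Rational.Base as ℚ using (ℚ; 0ℚ; 1ℚ; ½)
import Data.Rational.Properties as ℚ
open import Data.Rational.Solver using (module +-*-Solver)
import Data.Rational.Unnormalised.Base as ℚᵘ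
import Data.Rational.Unnormalised.Properties as ℚᵘ
open import Data.Sum.Base using (_⊎_; inj₁; inj₂)
open import Data.Tree.Binary using (leaf; node; module Leaves)
open import Data.Unit.Base using (⊤; tt)
open import Data.Vec.Properties.WithK using ([]=-irrelevant)
open import Function.Base using (_∘_; id)
import Function.Metric.Structures as Metric
open import Level using (0ℓ)
open import Relation.Binary.Bundles using (TotalOrder)
open import Relation.Binary.Core using (Rel)
open import Relation.Binary.Definitions using (Total; Symmetric)
open import Relation.Binary.PropositionalEquality
  using (_≡_; _≢_; refl; sym; trans; cong; cong₂; subst; setoid; isEquivalence; module ≡-Reasoning)
open import Relation.Binary.Structures using (IsPartialOrder)
open import Relation.Unary using (Decidable)
open import Relation.Nullary using (Dec; ¬_; yes; no; contradiction)
open import Relation.Nullary.Decidable using (⌊_⌋; ¬?; _×-dec_; decidable-stable)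

-- Real numbers

pointwise⇒≤ℝ : ∀ {x y} → (∀ n → seq x n ℚ.≤ seq y n) → x ≤ℝ y
pointwise⇒≤ℝ {x} {y} x≤y ε 0<ε = 0 , λ n _ → begin
  seq x n             ≤⟨ x≤y n ⟩
  seq y n             ≡⟨ ℚ.+-identityʳ _ ⟨
  seq y n ℚ.+ 0ℚ      ≤⟨ ℚ.+-monoʳ-≤ (seq y n) (ℚ.<⇒≤ 0<ε) ⟩
  seq y n ℚ.+ ε       ∎
  where open ℚ.≤-Reasoning

⊔ℝ-lub : ∀ {x y z} → x ≤ℝ z → y ≤ℝ z → x ⊔ℝ y ≤ℝ z
⊔ℝ-lub x≤z y≤z ε 0<ε with M , p ← x≤z ε 0<ε | N , q ← y≤z ε 0<ε
  = M ℕ.⊔ N , λ n h → ℚ.⊔-lub (p n (ℕ.m⊔n≤o⇒m≤o M N h)) (q n (ℕ.m⊔n≤o⇒n≤o M N h))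

-- If `x ≤ℝ y` fails, some ε has `x` above `y` by more than ε at arbitrarily late indices. Past the
-- Cauchy thresholds for ε/2 each sequence moves by less than ε/2, so from there on `y` stays below
-- `x`.
≤ℝ-total : ExcludedMiddle 0ℓ → Total _≤ℝ_
≤ℝ-total em x y with em {x ≤ℝ y}
... | yes x≤y = inj₁ x≤y
... | no  x≰y = inj₂ y≤x
  where
  gap : ∃[ ε ] 0ℚ ℚ.< ε × ¬ Eventually (λ n → seq x n ℚ.≤ seq y n ℚ.+ ε)
  gap = decidable-stable em λ ¬gap →
    x≰y λ ε 0<ε → decidable-stable em λ ¬ev → ¬gap (ε , 0<ε , ¬ev)

  y≤x : y ≤ℝ x
  y≤x δ 0<δ with ε , 0<ε , ¬ev ← gap
    with M , cx ← cauchy x (½ ℚ.* ε) (0<½* 0<ε) | N , cy ← cauchy y (½ ℚ.* ε) (0<½* 0<ε)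
    = M ℕ.⊔ N , bound
    where
    open ℚ.≤-Reasoning
    far : ∃[ n ] M ℕ.⊔ N ≤ n × seq y n ℚ.+ ε ℚ.< seq x n
    far = decidable-stable em λ ¬far → ¬ev (M ℕ.⊔ N , λ n h →
      ℚ.≮⇒≥ λ y+ε<x → ¬far (n , h , y+ε<x))

    bound : ∀ m → M ℕ.⊔ N ≤ m → seq y m ℚ.≤ seq x m ℚ.+ δ
    bound m h with n , k , y+ε<x ← far = ℚ.<⇒≤ (begin-strict
      seq y m
        <⟨ ∣-∣<⇒< (seq y m) (seq y n) (cy m n (ℕ.m⊔n≤o⇒n≤o M N h) (ℕ.m⊔n≤o⇒n≤o M N k)) ⟩
      seq y n ℚ.+ ½ ℚ.* ε
        -- Otherwise `seq x n` would be less than ε/2 above `seq x m`, hence below `seq y n ℚ.+ ε`,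
        -- against the choice of `n`.
        <⟨ ℚ.≰⇒> (λ x≤y+½ε → ℚ.<-irrefl refl (begin-strict
             seq x n
               <⟨ ∣-∣<⇒< (seq x n) (seq x m)
                    (cx n m (ℕ.m⊔n≤o⇒m≤o M N k) (ℕ.m⊔n≤o⇒m≤o M N h)) ⟩
             seq x m ℚ.+ ½ ℚ.* ε
               ≤⟨ ℚ.+-monoˡ-≤ (½ ℚ.* ε) x≤y+½ε ⟩
             seq y n ℚ.+ ½ ℚ.* ε ℚ.+ ½ ℚ.* ε
               ≡⟨ ℚ.+-assoc (seq y n) (½ ℚ.* ε) (½ ℚ.* ε) ⟩
             seq y n ℚ.+ (½ ℚ.* ε ℚ.+ ½ ℚ.* ε)
               ≡⟨ cong (seq y n ℚ.+_) (½+½ ε) ⟩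
             seq y n ℚ.+ ε
               <⟨ y+ε<x ⟩
             seq x n ∎)) ⟩
      seq x m
        ≡⟨ ℚ.+-identityʳ _ ⟨
      seq x m ℚ.+ 0ℚ
        <⟨ ℚ.+-monoʳ-< (seq x m) 0<δ ⟩
      seq x m ℚ.+ δ ∎)

+ℝ-mono-≤ : ∀ {x y z w} → x ≤ℝ y → z ≤ℝ w → x +ℝ z ≤ℝ y +ℝ w
+ℝ-mono-≤ {x} {y} {z} {w} x≤y z≤w ε 0<ε
  with M , p ← x≤y (½ ℚ.* ε) (0<½* 0<ε) | N , q ← z≤w (½ ℚ.* ε) (0<½* 0<ε)
  = M ℕ.⊔ N , λ n h → begin
      seq x n ℚ.+ seq z n
        ≤⟨ ℚ.+-mono-≤ (p n (ℕ.m⊔n≤o⇒m≤o M N h)) (q n (ℕ.m⊔n≤o⇒n≤o M N h)) ⟩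
      (seq y n ℚ.+ ½ ℚ.* ε) ℚ.+ (seq w n ℚ.+ ½ ℚ.* ε)
        ≡⟨ solve 3 (λ a b c → (a :+ c) :+ (b :+ c) := a :+ b :+ (c :+ c)) refl
             (seq y n) (seq w n) (½ ℚ.* ε) ⟩
      seq y n ℚ.+ seq w n ℚ.+ (½ ℚ.* ε ℚ.+ ½ ℚ.* ε)
        ≡⟨ cong (seq y n ℚ.+ seq w n ℚ.+_) (½+½ ε) ⟩
      seq y n ℚ.+ seq w n ℚ.+ ε ∎
  where
  open ℚ.≤-Reasoning
  open +-*-Solver

*-perturb : ∀ {B δ ε} w x y → 0ℚ ℚ.≤ w → w ℚ.≤ B → 0ℚ ℚ.≤ δ → 0ℚ ℚ.< ε →
  B ℚ.* δ ≡ ½ ℚ.* ε → x ℚ.≤ y ℚ.+ δ → w ℚ.* x ℚ.≤ w ℚ.* y ℚ.+ ε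
*-perturb {B} {δ} {ε} w x y 0≤w w≤B 0≤δ 0<ε Bδ≡ x≤y+δ = begin
  w ℚ.* x                         ≤⟨ ℚ.*-monoˡ-≤-nonNeg w {{ℚ.nonNegative 0≤w}} x≤y+δ ⟩
  w ℚ.* (y ℚ.+ δ)                 ≡⟨ ℚ.*-distribˡ-+ w y δ ⟩
  w ℚ.* y ℚ.+ w ℚ.* δ             ≤⟨ ℚ.+-monoʳ-≤ (w ℚ.* y)
                                       (ℚ.*-monoʳ-≤-nonNeg δ {{ℚ.nonNegative 0≤δ}} w≤B) ⟩
  w ℚ.* y ℚ.+ B ℚ.* δ             ≡⟨ cong (w ℚ.* y ℚ.+_) Bδ≡ ⟩
  w ℚ.* y ℚ.+ ½ ℚ.* ε             ≡⟨ cong (w ℚ.* y ℚ.+_) (ℚ.+-identityʳ (½ ℚ.* ε)) ⟨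
  w ℚ.* y ℚ.+ (½ ℚ.* ε ℚ.+ 0ℚ)    ≤⟨ ℚ.+-monoʳ-≤ (w ℚ.* y)
                                       (ℚ.+-monoʳ-≤ (½ ℚ.* ε) (ℚ.<⇒≤ (0<½* 0<ε))) ⟩
  w ℚ.* y ℚ.+ (½ ℚ.* ε ℚ.+ ½ ℚ.* ε)  ≡⟨ cong (w ℚ.* y ℚ.+_) (½+½ ε) ⟩
  w ℚ.* y ℚ.+ ε                   ∎
  where open ℚ.≤-Reasoning

-- A positive real has eventually nonnegative terms, and a Cauchy sequence is eventually bounded by
-- some `B`. Multiplication by `w` thus scales an error δ to at most `B ℚ.* δ`, and δ is chosen to
-- make this ε/2.
*ℝ-monoˡ-≤-pos : ∀ {w x y} → 0ℝ <ℝ w → x ≤ℝ y → w *ℝ x ≤ℝ w *ℝ y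
*ℝ-monoˡ-≤-pos {w} {x} {y} (η , 0<η , K , η≤w) x≤y ε 0<ε = bounded (eventually-bounded (cauchy w))
  where
  Goal = Eventually λ n → seq w n ℚ.* seq x n ℚ.≤ seq w n ℚ.* seq y n ℚ.+ ε

  0≤w : ∀ n → K ≤ n → 0ℚ ℚ.≤ seq w n
  0≤w n k = ℚ.≤-trans (ℚ.<⇒≤ 0<η) (subst (ℚ._≤ seq w n) (ℚ.+-identityˡ η) (η≤w n k))

  perturbed : ∀ {B L} → (∀ n → L ≤ n → ℚ.∣ seq w n ∣ ℚ.≤ B) →
    ∃[ δ ] 0ℚ ℚ.< δ × B ℚ.* δ ≡ ½ ℚ.* ε → Goal
  perturbed {L = L} w≤B (δ , 0<δ , Bδ≡) with M , p ← x≤y δ 0<δ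
    = K ℕ.⊔ L ℕ.⊔ M , λ n h →
        let k = ℕ.m⊔n≤o⇒m≤o K L (ℕ.m⊔n≤o⇒m≤o (K ℕ.⊔ L) M h)
            l = ℕ.m⊔n≤o⇒n≤o K L (ℕ.m⊔n≤o⇒m≤o (K ℕ.⊔ L) M h)
            m = ℕ.m⊔n≤o⇒n≤o (K ℕ.⊔ L) M h
        in *-perturb (seq w n) (seq x n) (seq y n) (0≤w n k)
             (ℚ.≤-trans (p≤∣p∣ (seq w n)) (w≤B n l)) (ℚ.<⇒≤ 0<δ) 0<ε Bδ≡ (p n m)

  bounded : ∃[ B ] 0ℚ ℚ.< B × (Eventually λ n → ℚ.∣ seq w n ∣ ℚ.≤ B) → Goal
  bounded (B , 0<B , L , w≤B) = perturbed w≤B (half-quotient 0<B 0<ε)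

sumℝ-map-mono-≤ : ∀ {A : Set} {f g : A → ℝ} xs →
  (∀ {x} → x ∈ˡ xs → f x ≤ℝ g x) → sumℝ (map f xs) ≤ℝ sumℝ (map g xs)
sumℝ-map-mono-≤ []       f≤g = pointwise⇒≤ℝ {0ℝ} {0ℝ} λ _ → ℚ.≤-refl
sumℝ-map-mono-≤ {f = f} {g} (x ∷ xs) f≤g =
  +ℝ-mono-≤ {f x} {g x} {sumℝ (map f xs)} {sumℝ (map g xs)}
    (f≤g (here refl)) (sumℝ-map-mono-≤ xs (f≤g ∘ there))

-- The comparison passes through unnormalised fractions, where both denominators are visibly 1.
/1-mono-≤ : ∀ {k m} → k ≤ m → ℤ.+ k ℚ./ 1 ℚ.≤ ℤ.+ m ℚ./ 1
/1-mono-≤ {k} {m} k≤m = ℚ.toℚᵘ-cancel-≤ (begin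
  ℚ.toℚᵘ (ℤ.+ k ℚ./ 1)     ≃⟨ ℚ.toℚᵘ-fromℚᵘ (ℚᵘ.mkℚᵘ (ℤ.+ k) 0) ⟩
  ℚᵘ.mkℚᵘ (ℤ.+ k) 0        ≤⟨ ℚᵘ.*≤* (ℤ.*-monoʳ-≤-nonNeg (ℤ.+ 1) (ℤ.+≤+ k≤m)) ⟩
  ℚᵘ.mkℚᵘ (ℤ.+ m) 0        ≃⟨ ℚ.toℚᵘ-fromℚᵘ (ℚᵘ.mkℚᵘ (ℤ.+ m) 0) ⟨
  ℚ.toℚᵘ (ℤ.+ m ℚ./ 1)     ∎)
  where open ℚᵘ.≤-Reasoning

fromℕ-mono-≤ : ∀ {k m} → k ≤ m → fromℕ k ≤ℝ fromℕ m
fromℕ-mono-≤ {k} {m} k≤m = pointwise⇒≤ℝ {fromℕ k} {fromℕ m} λ _ → /1-mono-≤ k≤m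

-- A successor is at least 1, while closeness to 0 with tolerance 1 would put it below 1.
fromℕ≈0⇒≡0 : ∀ {k} → fromℕ k ≈ℝ 0ℝ → k ≡ 0
fromℕ≈0⇒≡0 {zero}  _   = refl
fromℕ≈0⇒≡0 {suc k} k≈0 with N , h ← k≈0 1ℚ (ℚ.positive⁻¹ 1ℚ)
  = contradiction (ℚ.<-≤-trans k<1 (/1-mono-≤ {1} {suc k} (s≤s z≤n))) (ℚ.<-irrefl refl)
  where
  k<1 : ℤ.+ suc k ℚ./ 1 ℚ.< 1ℚ
  k<1 = ∣-∣<⇒< (ℤ.+ suc k ℚ./ 1) 0ℚ (h N ℕ.≤-refl)

≤⊎≤⇒fromℕ-≤-⊔ : ∀ {k l m} → k ≤ l ⊎ k ≤ m → fromℕ k ≤ℝ fromℕ l ⊔ℝ fromℕ m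
≤⊎≤⇒fromℕ-≤-⊔ {k} {l} {m} (inj₁ k≤l) = pointwise⇒≤ℝ {fromℕ k} {fromℕ l ⊔ℝ fromℕ m} λ _ →
  ℚ.≤-trans (/1-mono-≤ k≤l) (ℚ.p≤p⊔q (ℤ.+ l ℚ./ 1) (ℤ.+ m ℚ./ 1))
≤⊎≤⇒fromℕ-≤-⊔ {k} {l} {m} (inj₂ k≤m) = pointwise⇒≤ℝ {fromℕ k} {fromℕ l ⊔ℝ fromℕ m} λ _ →
  ℚ.≤-trans (/1-mono-≤ k≤m) (ℚ.p≤q⊔p (ℤ.+ l ℚ./ 1) (ℤ.+ m ℚ./ 1))

-- Walks

Reach : {A : Set} → Rel A 0ℓ → Rel A 0ℓ
Reach R x y = ∃[ k ] Walk R k x y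

module _ {A : Set} {R : Rel A 0ℓ} where

  reach-trans : ∀ {x y z} → Reach R x y → Reach R y z → Reach R x z
  reach-trans (zero  , refl)      q = q
  reach-trans (suc k , w , e , p) q with j , r ← reach-trans (k , p) q = suc j , w , e , r

  reach-sym : Symmetric R → Symmetric (Reach R)
  reach-sym R-sym (zero  , refl)      = zero , refl
  reach-sym R-sym (suc k , w , e , p) =
    reach-trans (reach-sym R-sym (k , p)) (1 , _ , R-sym e , refl)

  reach-map : ∀ {B : Set} {S : Rel B 0ℓ} (f : A → B) → (∀ {x y} → R x y → S (f x) (f y)) →
    ∀ {x y} → Reach R x y → Reach S (f x) (f y)
  reach-map f f-pres (zero  , refl)      = zero , refl
  reach-map f f-pres (suc k , w , e , p) with j , q ← reach-map f f-pres (k , p)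
    = suc j , f w , f-pres e , q

  reach-hub⇒connected : Symmetric R → ∀ h → (∀ x → Reach R x h) → Connected R
  reach-hub⇒connected R-sym h hub x y = reach-trans (hub x) (reach-sym R-sym (hub y))

-- Follow the walk while it stays in `S`; its first step out of `S` is the required edge.
walk-exits : ∀ {n} {R : Rel (Fin n) 0ℓ} (S : Subset n) k {x y} → Walk R k x y → x ∈ S → y ∉ S →
  ∃₂ λ a b → a ∈ S × b ∉ S × R a b
walk-exits S zero    refl        x∈S y∉S = contradiction x∈S y∉S
walk-exits S (suc k) (w , e , p) x∈S y∉S with w ∈? S
... | yes w∈S = walk-exits S k p w∈S y∉S
... | no  w∉S = _ , w , x∈S , w∉S , e

-- Lists up to permutation

module _ {A : Set} where

  -- Brings the tree that contains a given vertex to the front of a forest.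
  extract : ∀ {P : A → Set} {xs} → Any P xs → ∃₂ λ x ys → P x × xs ↭ x ∷ ys
  extract {xs = x ∷ xs} (here px) = x , xs , px , ↭-refl
  extract {xs = x ∷ xs} (there i) with y , ys , py , p ← extract i
    = y , x ∷ ys , py , ↭-trans (prep x p) (swap x y ↭-refl)

  unique-++⁻ : ∀ (xs : List A) {ys} → Unique (xs ++ ys) →
    Unique xs × Unique ys × (∀ {x} → x ∈ˡ xs → x ∈ˡ ys → ⊥)
  unique-++⁻ []       uys = [] , uys , λ ()
  unique-++⁻ (x ∷ xs) (x∉ ∷ u) with uxs , uys , disjoint ← unique-++⁻ xs u
    = All.++⁻ˡ xs x∉ ∷ uxs , uys
    , λ { (here refl) y∈ → All.lookup x∉ (∈-++⁺ʳ xs y∈) refl ; (there i) y∈ → disjoint i y∈ }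

  concatMap-↭ : ∀ {B : Set} (f : A → List B) {xs ys} → xs ↭ ys → concatMap f xs ↭ concatMap f ys
  concatMap-↭ f _↭_.refl          = ↭-refl
  concatMap-↭ f (prep x p)        = ++⁺ˡ (f x) (concatMap-↭ f p)
  concatMap-↭ f (swap x y p) =
    ↭-trans (shifts (f x) (f y)) (++⁺ˡ (f y) (++⁺ˡ (f x) (concatMap-↭ f p)))
  concatMap-↭ f (_↭_.trans p q)   = ↭-trans (concatMap-↭ f p) (concatMap-↭ f q)

↭-allFin⇒unique : ∀ {n} {xs : List (Fin n)} → xs ↭ allFin n → Unique xs
↭-allFin⇒unique {n} p = Permutationₛ.Unique-resp-↭ (setoid (Fin n)) (↭⇒↭ₛ (↭-sym p)) (allFin⁺ n)

-- Clusters and lowest common ancestors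

-- Leaves are collected with an accumulator; this recovers the recursion by concatenation.
toDiffList-++ : ∀ {n} (T : BinaryTree n) xs → Leaves.toDiffList T xs ≡ Leaves.toList T ++ xs
toDiffList-++ (leaf x)     xs = refl
toDiffList-++ (node l _ r) xs = begin
  Leaves.toDiffList l (Leaves.toDiffList r xs)
    ≡⟨ toDiffList-++ l _ ⟩
  Leaves.toList l ++ Leaves.toDiffList r xs
    ≡⟨ cong (Leaves.toList l ++_) (toDiffList-++ r xs) ⟩
  Leaves.toList l ++ Leaves.toList r ++ xs
    ≡⟨ List.++-assoc (Leaves.toList l) _ xs ⟨
  (Leaves.toList l ++ Leaves.toList r) ++ xs
    ≡⟨ cong (_++ xs) (toDiffList-++ l _) ⟨
  Leaves.toDiffList l (Leaves.toList r) ++ xs ∎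
  where open ≡-Reasoning

toList-node : ∀ {n} (l r : BinaryTree n) →
  Leaves.toList (node l tt r) ≡ Leaves.toList l ++ Leaves.toList r
toList-node l r = toDiffList-++ l (Leaves.toList r)

module _ {n : ℕ} where

  ∈-toList⇒∈-cluster : ∀ T {x : Fin n} → x ∈ˡ Leaves.toList T → x ∈ cluster T
  ∈-toList⇒∈-cluster (leaf y)     (here refl) = x∈⁅x⁆ y
  ∈-toList⇒∈-cluster (node l _ r) x∈ with ∈-++⁻ (Leaves.toList l) (subst (_ ∈ˡ_) (toList-node l r) x∈)
  ... | inj₁ x∈l = x∈p∪q⁺ (inj₁ (∈-toList⇒∈-cluster l x∈l))
  ... | inj₂ x∈r = x∈p∪q⁺ (inj₂ (∈-toList⇒∈-cluster r x∈r))

  ∈-cluster⇒∈-toList : ∀ T {x : Fin n} → x ∈ cluster T → x ∈ˡ Leaves.toList T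
  ∈-cluster⇒∈-toList (leaf y)     x∈ = here (x∈⁅y⁆⇒x≡y y x∈)
  ∈-cluster⇒∈-toList (node l _ r) x∈ = subst (_ ∈ˡ_) (sym (toList-node l r)) (split (x∈p∪q⁻ _ _ x∈))
    where
    split : _ ∈ cluster l ⊎ _ ∈ cluster r → _ ∈ˡ Leaves.toList l ++ Leaves.toList r
    split (inj₁ x∈l) = ∈-++⁺ˡ (∈-cluster⇒∈-toList l x∈l)
    split (inj₂ x∈r) = ∈-++⁺ʳ (Leaves.toList l) (∈-cluster⇒∈-toList r x∈r)

  root : (T : BinaryTree n) → ∃[ x ] x ∈ cluster T
  root (leaf x) = x , x∈⁅x⁆ x
  root (node l _ r) with x , x∈l ← root l = x , p⊆p∪q _ x∈l

  -- Distinctness of the leaves, in the form that recursion on the tree uses.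
  Separated : BinaryTree n → Set
  Separated (leaf _)     = ⊤
  Separated (node l _ r) =
    Separated l × Separated r × (∀ {x} → x ∈ cluster l → x ∈ cluster r → ⊥)

  unique⇒separated : ∀ T → Unique (Leaves.toList T) → Separated T
  unique⇒separated (leaf _)     _ = tt
  unique⇒separated (node l _ r) u
    with ul , ur , disjoint ← unique-++⁻ (Leaves.toList l) (subst Unique (toList-node l r) u)
    = unique⇒separated l ul , unique⇒separated r ur
    , λ x∈l x∈r → disjoint (∈-cluster⇒∈-toList l x∈l) (∈-cluster⇒∈-toList r x∈r)

  clusters-⊆ : ∀ (T : BinaryTree n) {C} → C ∈ˡ clusters T → C ⊆ cluster T
  clusters-⊆ (leaf _)     (here refl) = id
  clusters-⊆ (node l _ r) (here refl) = id
  clusters-⊆ (node l _ r) (there C∈) with ∈-++⁻ (clusters l) C∈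
  ... | inj₁ C∈l = p⊆p∪q _ ∘ clusters-⊆ l C∈l
  ... | inj₂ C∈r = q⊆p∪q _ _ ∘ clusters-⊆ r C∈r

  -- If one cluster is the root, it contains the other. If both lie in the same subtree, recurse.
  -- Clusters in different subtrees cannot share `x`, by separation.
  laminar : ∀ (T : BinaryTree n) → Separated T → ∀ {C D x} → C ∈ˡ clusters T → D ∈ˡ clusters T →
    x ∈ C → x ∈ D → C ⊆ D ⊎ D ⊆ C
  laminar (leaf _) _ (here refl) (here refl) _ _ = inj₁ id
  laminar T@(node _ _ _) _ (here refl) D∈ _ _ = inj₂ (clusters-⊆ T D∈)
  laminar T@(node _ _ _) _ C∈@(there _) (here refl) _ _ = inj₁ (clusters-⊆ T C∈)
  laminar (node l _ r) (sl , sr , disjoint) (there C∈) (there D∈) x∈C x∈D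
    with ∈-++⁻ (clusters l) C∈ | ∈-++⁻ (clusters l) D∈
  ... | inj₁ C∈l | inj₁ D∈l = laminar l sl C∈l D∈l x∈C x∈D
  ... | inj₂ C∈r | inj₂ D∈r = laminar r sr C∈r D∈r x∈C x∈D
  ... | inj₁ C∈l | inj₂ D∈r = contradiction (clusters-⊆ r D∈r x∈D) (disjoint (clusters-⊆ l C∈l x∈C))
  ... | inj₂ C∈r | inj₁ D∈l = contradiction (clusters-⊆ r C∈r x∈C) (disjoint (clusters-⊆ l D∈l x∈D))

  -- Case analysis on the nested conditionals of `lcaCluster`, for an arbitrary property, so that
  -- later proofs only treat the three mathematical cases.
  lcaCluster-node : ∀ (P : Subset n → Set) l {m} r {x y} →
    (x ∈ cluster l → y ∈ cluster l → P (lcaCluster l x y)) →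
    (x ∈ cluster r → y ∈ cluster r → P (lcaCluster r x y)) →
    (¬ (x ∈ cluster l × y ∈ cluster l) → ¬ (x ∈ cluster r × y ∈ cluster r) →
      P (cluster l ∪ cluster r)) →
    P (lcaCluster (node l m r) x y)
  lcaCluster-node P l r {x} {y} left right apart
    with (x ∈? cluster l) ×-dec (y ∈? cluster l)
  ... | yes (x∈l , y∈l) = left x∈l y∈l
  ... | no  ¬l with (x ∈? cluster r) ×-dec (y ∈? cluster r)
  ...   | yes (x∈r , y∈r) = right x∈r y∈r
  ...   | no  ¬r          = apart ¬l ¬r

  lcaCluster-∈ : ∀ T x y → lcaCluster T x y ∈ˡ clusters T
  lcaCluster-∈ (leaf _)     x y = here refl
  lcaCluster-∈ (node l _ r) x y = lcaCluster-node (_∈ˡ clusters (node l tt r)) l r {x} {y}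
    (λ _ _ → there (∈-++⁺ˡ (lcaCluster-∈ l x y)))
    (λ _ _ → there (∈-++⁺ʳ (clusters l) (lcaCluster-∈ r x y)))
    (λ _ _ → here refl)

  lcaCluster-∋ : ∀ T {x y} → x ∈ cluster T → y ∈ cluster T →
    x ∈ lcaCluster T x y × y ∈ lcaCluster T x y
  lcaCluster-∋ (leaf _)     x∈ y∈ = x∈ , y∈
  lcaCluster-∋ (node l _ r) {x} {y} x∈ y∈ = lcaCluster-node (λ C → x ∈ C × y ∈ C) l r
    (lcaCluster-∋ l) (lcaCluster-∋ r) (λ _ _ → x∈ , y∈)

  -- A cluster `C` below one child puts both vertices in that child. Disjointness then rules out the
  -- other child, and the root case contradicts its own negated condition, so only the recursive
  -- case is left.
  lcaCluster-least : ∀ T → Separated T → ∀ {C x y} → C ∈ˡ clusters T → x ∈ C → y ∈ C →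
    lcaCluster T x y ⊆ C
  lcaCluster-least (leaf _) _ (here refl) _ _ = id
  lcaCluster-least T@(node _ _ _) _ {x = x} {y} (here refl) _ _ =
    clusters-⊆ T (lcaCluster-∈ T x y)
  lcaCluster-least (node l _ r) (sl , sr , disjoint) {C} {x} {y} (there C∈) x∈C y∈C
    with ∈-++⁻ (clusters l) C∈
  ... | inj₁ C∈l = lcaCluster-node (_⊆ C) l r {x} {y}
          (λ _ _ → lcaCluster-least l sl C∈l x∈C y∈C)
          (λ x∈r _ → contradiction x∈r (disjoint (clusters-⊆ l C∈l x∈C)))
          (λ ¬l _ → contradiction (clusters-⊆ l C∈l x∈C , clusters-⊆ l C∈l y∈C) ¬l)
  ... | inj₂ C∈r = lcaCluster-node (_⊆ C) l r {x} {y}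
          (λ x∈l _ → contradiction (clusters-⊆ r C∈r x∈C) (disjoint x∈l))
          (λ _ _ → lcaCluster-least r sr C∈r x∈C y∈C)
          (λ _ ¬r → contradiction (clusters-⊆ r C∈r x∈C , clusters-⊆ r C∈r y∈C) ¬r)

-- Diameters

module _ {n : ℕ} (d : Fin n → Fin n → ℕ) where

  ≤-diam : ∀ {S x y} → x ∈ S → y ∈ S → d x y ≤ diam d S
  ≤-diam {S} x∈S y∈S = All.lookup (Max.xs≤max 0 _)
    (∈-cartesianProductWith⁺ d (∈-filter⁺ (_∈? S) (∈-allFin _) x∈S)
                               (∈-filter⁺ (_∈? S) (∈-allFin _) y∈S))

  -- The maximum is either one of the listed distances or its default value 0, hence the premise
  -- `P 0`.
  diam-elim : ∀ (P : ℕ → Set) S → P 0 → (∀ {x y} → x ∈ S → y ∈ S → P (d x y)) → P (diam d S)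
  diam-elim P S p0 pd = Max.argmax-all id {P = P} p0 (All.tabulate entry)
    where
    members = filter (_∈? S) (allFin n)
    entry : ∀ {k} → k ∈ˡ _ → P k
    entry k∈ with _ , _ , x∈ , y∈ , refl ← ∈-cartesianProductWith⁻ d members members k∈
      = pd (proj₂ (∈-filter⁻ (_∈? S) {xs = allFin n} x∈))
           (proj₂ (∈-filter⁻ (_∈? S) {xs = allFin n} y∈))

  diam-mono : ∀ {S S′} → S ⊆ S′ → diam d S ≤ diam d S′
  diam-mono {S} {S′} S⊆S′ =
    diam-elim (_≤ diam d S′) S z≤n λ x∈S y∈S → ≤-diam (S⊆S′ x∈S) (S⊆S′ y∈S)

  -- diamLabel d T x y is definitionally fromℕ (label T x y).
  label : BinaryTree n → Fin n → Fin n → ℕ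
  label T x y = if ⌊ x Fin.≟ y ⌋ then 0 else diam d (lcaCluster T x y)

  label-refl : ∀ T x → label T x x ≡ 0
  label-refl T x with x Fin.≟ x
  ... | yes _   = refl
  ... | no  x≢x = contradiction refl x≢x

  label-≤-diam : ∀ T x y → label T x y ≤ diam d (lcaCluster T x y)
  label-≤-diam T x y with x Fin.≟ y
  ... | yes _ = z≤n
  ... | no  _ = ℕ.≤-refl

  diam-≤-label : ∀ T {x y} → x ≢ y → diam d (lcaCluster T x y) ≤ label T x y
  diam-≤-label T {x} {y} x≢y with x Fin.≟ y
  ... | yes x≡y = contradiction x≡y x≢y
  ... | no  _   = ℕ.≤-refl

  module _ (T : BinaryTree n) (separated : Separated T) (full : ∀ x → x ∈ cluster T) where

    private
      ∋ˡ : ∀ x y → x ∈ lcaCluster T x y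
      ∋ˡ x y = proj₁ (lcaCluster-∋ T (full x) (full y))

      ∋ʳ : ∀ x y → y ∈ lcaCluster T x y
      ∋ʳ x y = proj₂ (lcaCluster-∋ T (full x) (full y))

      lca-least : ∀ {C x y} → C ∈ˡ clusters T → x ∈ C → y ∈ C → lcaCluster T x y ⊆ C
      lca-least = lcaCluster-least T separated

    label-≤-sym : ∀ x y → label T x y ≤ label T y x
    label-≤-sym x y with x Fin.≟ y
    ... | yes _   = z≤n
    ... | no  x≢y = ℕ.≤-trans
      (diam-mono (lca-least (lcaCluster-∈ T y x) (∋ʳ y x) (∋ˡ y x)))
      (diam-≤-label T (x≢y ∘ sym))

    label-triangle : ∀ x y z → label T x z ≤ label T x y ⊎ label T x z ≤ label T y z
    label-triangle x y z = split (x Fin.≟ y) (y Fin.≟ z)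
      where
      split : Dec (x ≡ y) → Dec (y ≡ z) → label T x z ≤ label T x y ⊎ label T x z ≤ label T y z
      -- Coinciding points are split off because `diam-≤-label` bounds the diameter only for
      -- distinct ones.
      split (yes refl) _          = inj₂ ℕ.≤-refl
      split (no _)     (yes refl) = inj₁ ℕ.≤-refl
      split (no x≢y)   (no y≢z)
        with laminar T separated (lcaCluster-∈ T x y) (lcaCluster-∈ T y z) (∋ʳ x y) (∋ˡ y z)
      ... | inj₁ xy⊆yz = inj₂ (ℕ.≤-trans (label-≤-diam T x z) (ℕ.≤-trans
              (diam-mono (lca-least (lcaCluster-∈ T y z) (xy⊆yz (∋ˡ x y)) (∋ʳ y z)))
              (diam-≤-label T y≢z)))
      ... | inj₂ yz⊆xy = inj₁ (ℕ.≤-trans (label-≤-diam T x z) (ℕ.≤-trans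
              (diam-mono (lca-least (lcaCluster-∈ T x y) (∋ˡ x y) (yz⊆xy (∋ʳ y z))))
              (diam-≤-label T x≢y)))

    ≤-label : (∀ x → d x x ≡ 0) → ∀ x y → d x y ≤ label T x y
    ≤-label d-refl x y with x Fin.≟ y
    ... | yes refl = ℕ.≤-reflexive (d-refl x)
    ... | no  _    = ≤-diam (∋ˡ x y) (∋ʳ x y)

    -- The metric structure includes a partial order on the reals. It is taken as an argument and
    -- later supplied by the given ultrametric `u`.
    diamLabel-isUltrametric : IsPartialOrder _≈ℝ_ _≤ℝ_ →
      (∀ x → d x x ≡ 0) → (∀ {x y} → d x y ≡ 0 → x ≡ y) → IsUltrametric (diamLabel d T)
    diamLabel-isUltrametric isPartialOrder d-refl d-zero = record
      { isSemiMetric = record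
        { isQuasiSemiMetric = record
          { isPreMetric = record
            { isProtoMetric = record
              { isPartialOrder  = isPartialOrder
              ; ≈-isEquivalence = isEquivalence
              ; cong            = λ {x} x≡y z≡w → fromℕ-cong (cong₂ (label T) x≡y z≡w)
              ; nonNegative     = λ {x} {y} → fromℕ-mono-≤ {0} {label T x y} z≤n
              }
            ; ≈⇒0 = λ { {x} refl → fromℕ-cong (label-refl T x) }
            }
          ; 0⇒≈ = λ {x} {y} ≈0 → d-zero (ℕ.n≤0⇒n≡0 (ℕ.≤-trans (≤-label d-refl x y)
              (ℕ.≤-reflexive (fromℕ≈0⇒≡0 {label T x y} ≈0))))
          }
        ; sym = λ x y → fromℕ-cong (ℕ.≤-antisym (label-≤-sym x y) (label-≤-sym y x))
        }
      ; triangle = λ x y z → ≤⊎≤⇒fromℕ-≤-⊔ {label T x z} {label T x y} {label T y z}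
          (label-triangle x y z)
      }
      where
      open IsPartialOrder isPartialOrder using (module Eq)
      fromℕ-cong : ∀ {k m} → k ≡ m → fromℕ k ≈ℝ fromℕ m
      fromℕ-cong {k} refl = Eq.refl {fromℕ k}

-- Edges and the shortest-path metric

module _ {n : ℕ} (G : WeightedGraph n) where

  open WeightedGraph G

  ∈-edges⇒adj : ∀ {x y} → (x , y) ∈ˡ edges G → Adj x y
  ∈-edges⇒adj e∈ = proj₂ (proj₂ (∈-filter⁻ (λ (x , y) → (x Fin.<? y) ×-dec adj? x y)
    {xs = cartesianProduct (allFin n) (allFin n)} e∈))

  module _ (connected : Connected Adj) where

    dist-refl : ∀ x → dist G connected x x ≡ 0
    dist-refl x =
      ℕ.n≤0⇒n≡0 (proj₂ (proj₂ (least (λ k → walk? adj? k x x) (connected x x))) 0 refl)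

    dist≡0⇒≡ : ∀ {x y} → dist G connected x y ≡ 0 → x ≡ y
    dist≡0⇒≡ {x} {y} d≡0 = subst (λ k → Walk Adj k x y) d≡0
      (proj₁ (proj₂ (least (λ k → walk? adj? k x y) (connected x y))))

-- Single-linkage clustering

-- The clustering only compares values of `u`, so these range over an arbitrary total order. Without
-- a zero or a maximum operation, `u-min` stands for vanishing on the diagonal with nonnegativity,
-- and `u-ultra` states the strong triangle inequality through upper bounds `t`.
module SingleLinkage {n : ℕ} (G : WeightedGraph n) (connected : Connected (WeightedGraph.Adj G))
  (O : TotalOrder 0ℓ 0ℓ 0ℓ) (u : Fin n → Fin n → TotalOrder.Carrier O)
  (u-min : ∀ x a b → TotalOrder._≤_ O (u x x) (u a b))
  (u-sym : ∀ x y → TotalOrder._≤_ O (u x y) (u y x))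
  (u-ultra : ∀ x y z t → TotalOrder._≤_ O (u x y) t → TotalOrder._≤_ O (u y z) t →
    TotalOrder._≤_ O (u x z) t)
  where

  open WeightedGraph G
  open TotalOrder O using () renaming (_≤_ to _⊑_; trans to ⊑-trans)

  -- What is kept of the merging history: each internal node has a connected cluster, and any edge
  -- between its two sides bounds every `u`-distance inside that cluster.
  data Grown : BinaryTree n → Set where
    leaf : ∀ x → Grown (leaf x)
    node : ∀ {l r} → Grown l → Grown r →
      Connected (InducedAdj G (cluster l ∪ cluster r)) →
      (∀ {x y} → x ∈ cluster l → y ∈ cluster r → Adj x y →
        ∀ {a b} → a ∈ cluster l ∪ cluster r → b ∈ cluster l ∪ cluster r → u a b ⊑ u x y) →
      Grown (node l tt r)

  singleton-connected : ∀ x → Connected (InducedAdj G ⁅ x ⁆)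
  singleton-connected x (y , p) (z , q)
    -- Vertices of an induced subgraph carry membership proofs, which must be identified as well.
    with refl ← x∈⁅y⁆⇒x≡y x p | refl ← x∈⁅y⁆⇒x≡y x q = 0 , cong (x ,_) ([]=-irrelevant p q)

  grown-connected : ∀ {T} → Grown T → Connected (InducedAdj G (cluster T))
  grown-connected (leaf x)       = singleton-connected x
  grown-connected (node _ _ c _) = c

  grown-clusters : ∀ {T} → Grown T → All (λ S → Connected (InducedAdj G S)) (clusters T)
  grown-clusters (leaf x)         = singleton-connected x ∷ []
  grown-clusters (node gl gr c _) = c ∷ All.++⁺ (grown-clusters gl) (grown-clusters gr)

  singleton-spread : ∀ z {a b x y} → a ∈ ⁅ z ⁆ → b ∈ ⁅ z ⁆ → u a b ⊑ u x y
  singleton-spread z a∈ b∈ with refl ← x∈⁅y⁆⇒x≡y z a∈ | refl ← x∈⁅y⁆⇒x≡y z b∈ = u-min z _ _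

  Bounded : Fin n → Fin n → Subset n → Set
  Bounded x y C = ∀ {a b} → a ∈ C → b ∈ C → u a b ⊑ u x y

  -- At the lowest common ancestor the edge runs between the two children, so the node condition
  -- applies, up to reversing the edge and the symmetry of `u`.
  grown-lcaCluster : ∀ {T} → Grown T → ∀ {x y} → x ∈ cluster T → y ∈ cluster T → Adj x y →
    Bounded x y (lcaCluster T x y)
  grown-lcaCluster (leaf z) _ _ _ = singleton-spread z
  grown-lcaCluster (node {l} {r} gl gr _ cut) {x} {y} x∈ y∈ xy =
    lcaCluster-node (Bounded x y) l r {x} {y}
      (λ x∈l y∈l → grown-lcaCluster gl x∈l y∈l xy)
      (λ x∈r y∈r → grown-lcaCluster gr x∈r y∈r xy)
      (λ ¬l ¬r → apart ¬l ¬r (x∈p∪q⁻ _ _ x∈) (x∈p∪q⁻ _ _ y∈))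
    where
    apart : ¬ (x ∈ cluster l × y ∈ cluster l) → ¬ (x ∈ cluster r × y ∈ cluster r) →
      x ∈ cluster l ⊎ x ∈ cluster r → y ∈ cluster l ⊎ y ∈ cluster r →
      Bounded x y (cluster l ∪ cluster r)
    apart ¬l ¬r (inj₁ x∈l) (inj₁ y∈l) = contradiction (x∈l , y∈l) ¬l
    apart ¬l ¬r (inj₁ x∈l) (inj₂ y∈r) = cut x∈l y∈r xy
    apart ¬l ¬r (inj₂ x∈r) (inj₁ y∈l) = λ a∈ b∈ →
      ⊑-trans (cut y∈l x∈r (adj-sym xy) a∈ b∈) (u-sym y x)
    apart ¬l ¬r (inj₂ x∈r) (inj₂ y∈r) = contradiction (x∈r , y∈r) ¬r

  -- Forests and the edges crossing between their trees

  Together : List (BinaryTree n) → Fin n → Fin n → Set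
  Together F x y = Any (λ T → x ∈ cluster T × y ∈ cluster T) F

  Crossing : List (BinaryTree n) → Fin n → Fin n → Set
  Crossing F x y = Adj x y × ¬ Together F x y

  crossing? : ∀ F → Decidable (uncurry (Crossing F))
  crossing? F (x , y) =
    adj? x y ×-dec ¬? (Any.any? (λ T → (x ∈? cluster T) ×-dec (y ∈? cluster T)) F)

  Minimal : List (BinaryTree n) → Fin n → Fin n → Set
  Minimal F x y = ∀ {a b} → Crossing F a b → u x y ⊑ u a b

  -- The invariant of the algorithm. The permutation in `leaves` gives both disjointness and
  -- covering; `tight` records that the joins so far used edges of no larger `u` than any edge still
  -- available.
  record Forest (F : List (BinaryTree n)) : Set where
    field
      leaves : concatMap Leaves.toList F ↭ allFin n
      grown  : All Grown F
      tight  : ∀ {x y} → Crossing F x y →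
        All (λ T → Bounded x y (cluster T)) F

    covers : ∀ x → Any (λ T → x ∈ cluster T) F
    covers x = Any.map (λ {T} → ∈-toList⇒∈-cluster T)
      (∈-concatMap⁻ Leaves.toList (∈-resp-↭ (↭-sym leaves) (∈-allFin x)))

  open Forest

  crossing-resp-↭ : ∀ {F F′ x y} → F ↭ F′ → Crossing F x y → Crossing F′ x y
  crossing-resp-↭ p (xy , ¬t) = xy , ¬t ∘ Any-resp-↭ (↭-sym p)

  forest-resp-↭ : ∀ {F F′} → F ↭ F′ → Forest F → Forest F′
  forest-resp-↭ p f = record
    { leaves = ↭-trans (concatMap-↭ Leaves.toList (↭-sym p)) (leaves f)
    ; grown  = All-resp-↭ p (grown f)
    ; tight  = λ xy → All-resp-↭ p (tight f (crossing-resp-↭ (↭-sym p) xy))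
    }

  head-disjoint : ∀ {A F x} → Forest (A ∷ F) → x ∈ cluster A → ¬ Any (λ T → x ∈ cluster T) F
  head-disjoint {A} f x∈A x∈F
    with _ , _ , disjoint ← unique-++⁻ (Leaves.toList A) (↭-allFin⇒unique (leaves f))
    = disjoint (∈-cluster⇒∈-toList A x∈A)
        (∈-concatMap⁺ Leaves.toList (Any.map (λ {T} → ∈-cluster⇒∈-toList T) x∈F))

  singletons : Forest (map leaf (allFin n))
  singletons = record
    { leaves = ↭-reflexive (trans (cong concat (sym (List.map-∘ (allFin n))))
                                  (List.concat-map-[ allFin n ]))
    ; grown  = All.map⁺ (All.universal leaf (allFin n))
    -- Inside a singleton the only `u`-distance is a diagonal one, which is minimal by `u-min`.
    ; tight  = λ {x} {y} _ → All.map⁺ (All.universal {P = λ z → Bounded x y ⁅ z ⁆}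
        (λ z → singleton-spread z) (allFin n))
    }

  -- A walk in `G` from a vertex of `A` to one of `B` must leave `A`. The edge on which it does so
  -- has one end outside `A` and the other in no tree but `A`.
  crossing-exists : ∀ {A B F} → Forest (A ∷ B ∷ F) → ∃₂ (Crossing (A ∷ B ∷ F))
  crossing-exists {A} {B} f with x , x∈A ← root A | y , y∈B ← root B
    with k , p ← connected x y
    with a , b , a∈A , b∉A , ab ← walk-exits (cluster A) k p x∈A
           (λ y∈A → head-disjoint f y∈A (here y∈B))
    = a , b , ab , λ { (here (_ , b∈A)) → b∉A b∈A
                     ; (there t) → head-disjoint f a∈A (Any.map proj₁ t) }

  minimal-crossing : ∀ F → ∃₂ (Crossing F) → ∃₂ λ x y → Crossing F x y × Minimal F x y
  minimal-crossing F (x₀ , y₀ , c₀) = _ , _ , crossing , minimal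
    where
    open Extrema O using (argmin; argmin-all; f[argmin]≤f[xs])

    pairs crossings : List (Fin n × Fin n)
    pairs     = cartesianProduct (allFin n) (allFin n)
    crossings = filter (crossing? F) pairs

    e : Fin n × Fin n
    -- The default value is itself a crossing pair, so the result crosses in every case.
    e = argmin (uncurry u) (x₀ , y₀) crossings

    crossing : uncurry (Crossing F) e
    crossing = argmin-all (uncurry u) {P = uncurry (Crossing F)} c₀
      (All.tabulate λ i → proj₂ (∈-filter⁻ (crossing? F) {xs = pairs} i))

    minimal : Minimal F (proj₁ e) (proj₂ e)
    minimal c = All.lookup (f[argmin]≤f[xs] (x₀ , y₀) crossings)
      (∈-filter⁺ (crossing? F) (∈-cartesianProduct⁺ (∈-allFin _) (∈-allFin _)) c)

  -- Joining two trees along a minimal crossing edge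

  module Join {A B F} (f : Forest (A ∷ B ∷ F)) {x y} (x∈A : x ∈ cluster A) (y∈B : y ∈ cluster B)
              (xy : Crossing (A ∷ B ∷ F) x y) (minimal : Minimal (A ∷ B ∷ F) x y) where

    private
      S : Subset n
      S = cluster A ∪ cluster B

      A⊆S : cluster A ⊆ S
      A⊆S = p⊆p∪q _

      B⊆S : cluster B ⊆ S
      B⊆S = q⊆p∪q _ _

    -- Since `xy` crosses, `tight` bounds both old clusters by `u x y`. A vertex of `A` is compared
    -- with `x` directly, a vertex of `B` through `y` by the strong triangle inequality.
    to-hub : ∀ {a} → a ∈ S → u a x ⊑ u x y
    to-hub {a} a∈ with tA ∷ tB ∷ _ ← tight f xy | x∈p∪q⁻ _ _ a∈
    ... | inj₁ a∈A = tA a∈A x∈A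
    ... | inj₂ a∈B = u-ultra _ y _ _ (tB a∈B y∈B) (u-sym y x)

    spread-⊑ : ∀ {a b} → a ∈ S → b ∈ S → u a b ⊑ u x y
    spread-⊑ {b = b} a∈ b∈ = u-ultra _ x _ _ (to-hub a∈) (⊑-trans (u-sym x b) (to-hub b∈))

    -- Every vertex reaches `x`: within `A` directly, and from `B` by walking to `y` and then
    -- crossing the edge `xy`.
    joined-connected : Connected (InducedAdj G S)
    joined-connected = reach-hub⇒connected adj-sym (x , A⊆S x∈A) hub
      where
      within : ∀ {C} → C ⊆ S → Connected (InducedAdj G C) → ∀ {a b} → a ∈ C → b ∈ C →
        (a∈ : a ∈ S) (b∈ : b ∈ S) → Reach (InducedAdj G S) (a , a∈) (b , b∈)
      within C⊆S c {a} {b} a∈C b∈C a∈ b∈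
        -- Membership proofs are unique, so both endpoints become images under the inclusion of `C`.
        rewrite []=-irrelevant a∈ (C⊆S a∈C) | []=-irrelevant b∈ (C⊆S b∈C) =
        reach-map (λ (z , z∈C) → z , C⊆S z∈C) id (c (a , a∈C) (b , b∈C))

      hub : ∀ s → Reach (InducedAdj G S) s (x , A⊆S x∈A)
      hub (a , a∈) with gA ∷ gB ∷ _ ← grown f | x∈p∪q⁻ _ _ a∈
      ... | inj₁ a∈A = within A⊆S (grown-connected gA) a∈A x∈A a∈ _
      ... | inj₂ a∈B = reach-trans (within B⊆S (grown-connected gB) a∈B y∈B a∈ (B⊆S y∈B))
                         (1 , _ , adj-sym (proj₁ xy) , refl)

    apart : ∀ {a b} → a ∈ cluster A → b ∈ cluster B → ¬ Together (A ∷ B ∷ F) a b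
    apart a∈A b∈B (here (_ , b∈A)) = head-disjoint f b∈A (here b∈B)
    apart a∈A b∈B (there t)        = head-disjoint f a∈A (Any.map proj₁ t)

    -- Joining only enlarges trees, so the old minimality and tightness apply to every edge that
    -- still crosses.
    crossing-before : ∀ {a b} → Crossing (node A tt B ∷ F) a b → Crossing (A ∷ B ∷ F) a b
    crossing-before (ab , ¬t) = ab , λ where
      (here (a∈ , b∈))         → ¬t (here (A⊆S a∈ , A⊆S b∈))
      (there (here (a∈ , b∈))) → ¬t (here (B⊆S a∈ , B⊆S b∈))
      (there (there t))        → ¬t (there t)

    joined : Forest (node A tt B ∷ F)
    joined with gA ∷ gB ∷ gF ← grown f = record
      { leaves = ↭-trans (↭-reflexive regroup) (leaves f)
      ; grown  = node gA gB joined-connected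
          (λ a∈A b∈B ab p∈ q∈ → ⊑-trans (spread-⊑ p∈ q∈) (minimal (ab , apart a∈A b∈B))) ∷ gF
      -- The new cluster has spread at most `u x y`, which by minimality is at most `u a b`.
      ; tight  = λ {a} {b} ab → (λ p∈ q∈ → ⊑-trans (spread-⊑ p∈ q∈) (minimal (crossing-before ab)))
          ∷ All.tail (All.tail (tight f (crossing-before ab)))
      }
      where
      regroup : Leaves.toList (node A tt B) ++ concatMap Leaves.toList F ≡
                Leaves.toList A ++ Leaves.toList B ++ concatMap Leaves.toList F
      regroup = trans (cong (_++ _) (toList-node A B))
                      (List.++-assoc (Leaves.toList A) (Leaves.toList B) _)

  -- `A` and `B` only witness that at least two trees remain. The trees actually joined are `P` and
  -- `Q`, found from the ends of a minimal crossing edge.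
  merge : ∀ {A B F} → Forest (A ∷ B ∷ F) →
    ∃ λ F′ → Forest F′ × suc (length F′) ≡ length (A ∷ B ∷ F)
  merge {A} {B} {F} f with x , y , xy , minimal ← minimal-crossing _ (crossing-exists f)
    with P , F₁ , x∈P , p ← extract (covers f x)
    with covers (forest-resp-↭ p f) y
  -- With both ends in `P` the edge would not cross.
  ... | here y∈P = contradiction (Any-resp-↭ (↭-sym p) (here (x∈P , y∈P))) (proj₂ xy)
  ... | there y∈F₁ with Q , F₂ , y∈Q , q ← extract y∈F₁
    = node P tt Q ∷ F₂
    , Join.joined (forest-resp-↭ σ f) x∈P y∈Q (crossing-resp-↭ σ xy)
        (minimal ∘ crossing-resp-↭ (↭-sym σ))
    , sym (↭-length σ)
    where
    σ : A ∷ B ∷ F ↭ P ∷ Q ∷ F₂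
    σ = ↭-trans p (prep P q)

  -- Each merge shortens the forest by one tree, so `k` counts the joins that remain.
  agglomerate : ∀ k {F} → length F ≡ suc k → Forest F → ∃ λ T → Forest [ T ]
  agglomerate zero    {T ∷ []}    _   f = T , f
  agglomerate (suc k) {_ ∷ _ ∷ _} len f with F′ , f′ , len′ ← merge f
    = agglomerate k (ℕ.suc-injective (trans len′ len)) f′

  singleLinkageTree : n ≢ 0 → ∃ λ T → IsHierarchical T × Grown T
  singleLinkageTree n≢0 = unpack (agglomerate (ℕ.pred n) len singletons)
    where
    len : length (map {B = BinaryTree n} leaf (allFin n)) ≡ suc (ℕ.pred n)
    len = trans (List.length-map leaf (allFin n))
            (trans (List.length-tabulate id) (sym (ℕ.suc-pred n {{ℕ.≢-nonZero n≢0}})))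

    unpack : (∃ λ T → Forest [ T ]) → ∃ λ T → IsHierarchical T × Grown T
    unpack (T , f) = T
      , ↭-trans (↭-reflexive (sym (List.++-identityʳ (Leaves.toList T)))) (leaves f)
      , All.head (grown f)

-- Application to the real-valued ultrametric

lemma1 : ExcludedMiddle 0ℓ →
    ∀ (n : ℕ) → 2 ≤ n →
    (G : WeightedGraph n) (connected : Connected (WeightedGraph.Adj G)) →
    (u : Fin n → Fin n → ℝ) → IsUltrametric u → Dominates G connected u →
    ∃ λ (T : BinaryTree n) → IsHierarchical T
    × All (λ S → Connected (InducedAdj G S)) (clusters T)
    × (IsUltrametric (diamLabel (dist G connected) T)
    × Dominates G connected (diamLabel (dist G connected) T))
    × (∀ x y → WeightedGraph.Adj G x y → diamLabel (dist G connected) T x y ≤ℝ u x y)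
    × weightedSum G (diamLabel (dist G connected) T) ≤ℝ weightedSum G u
lemma1 em n 2≤n G connected u isUltrametric dominates =
  T , hierarchical , connected-clusters , (ultrametric , dominating) , edge-≤ , weightedSum-≤
  where
  open WeightedGraph G
  open Metric.IsGeneralMetric isUltrametric
    using (isPartialOrder; nonNegative; ≈⇒0; triangle)
    renaming (reflexive to ≤ℝ-reflexive; trans to ≤ℝ-trans; sym to u-sym)

  d : Fin n → Fin n → ℕ
  d = dist G connected

  d-refl : ∀ x → d x x ≡ 0
  d-refl = dist-refl G connected

  d≡0⇒≡ : ∀ {x y} → d x y ≡ 0 → x ≡ y
  d≡0⇒≡ = dist≡0⇒≡ G connected

  -- Excluded middle enters here: choosing a minimal edge requires a total order on the values of
  -- `u`.
  ≤ℝ-totalOrder : TotalOrder 0ℓ 0ℓ 0ℓ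
  ≤ℝ-totalOrder = record
    { isTotalOrder = record { isPartialOrder = isPartialOrder ; total = ≤ℝ-total em } }

  u-min : ∀ x a b → u x x ≤ℝ u a b
  u-min x a b = ≤ℝ-trans {u x x} {0ℝ} {u a b}
    (≤ℝ-reflexive {u x x} {0ℝ} (≈⇒0 {x} refl)) (nonNegative {a} {b})

  u-sym-≤ : ∀ x y → u x y ≤ℝ u y x
  u-sym-≤ x y = ≤ℝ-reflexive {u x y} {u y x} (u-sym x y)

  u-ultra : ∀ x y z t → u x y ≤ℝ t → u y z ≤ℝ t → u x z ≤ℝ t
  u-ultra x y z t xy≤t yz≤t = ≤ℝ-trans {u x z} {u x y ⊔ℝ u y z} {t}
    (triangle x y z) (⊔ℝ-lub {u x y} {u y z} {t} xy≤t yz≤t)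

  open SingleLinkage G connected ≤ℝ-totalOrder u u-min u-sym-≤ u-ultra

  tree : ∃ λ T → IsHierarchical T × Grown T
  tree = singleLinkageTree λ n≡0 → contradiction (subst (2 ≤_) n≡0 2≤n) λ ()

  T : BinaryTree n
  T = proj₁ tree

  hierarchical : IsHierarchical T
  hierarchical = proj₁ (proj₂ tree)

  T-grown : Grown T
  T-grown = proj₂ (proj₂ tree)

  connected-clusters : All (λ S → Connected (InducedAdj G S)) (clusters T)
  connected-clusters = grown-clusters T-grown

  separated : Separated T
  separated = unique⇒separated T (↭-allFin⇒unique hierarchical)

  full : ∀ x → x ∈ cluster T
  full x = ∈-toList⇒∈-cluster T (∈-resp-↭ (↭-sym hierarchical) (∈-allFin x))

  ultrametric : IsUltrametric (diamLabel d T)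
  ultrametric = diamLabel-isUltrametric d T separated full isPartialOrder d-refl d≡0⇒≡

  dominating : Dominates G connected (diamLabel d T)
  dominating x y = fromℕ-mono-≤ {d x y} {label d T x y} (≤-label d T separated full d-refl x y)

  -- For `a` and `b` in the lowest common cluster, `d a b` is at most `u a b` by domination, and
  -- `u a b` is at most `u x y` by single linkage. Nonnegativity of `u` covers the default value of
  -- the diameter.
  edge-≤ : ∀ x y → Adj x y → diamLabel d T x y ≤ℝ u x y
  edge-≤ x y xy = ≤ℝ-trans {diamLabel d T x y} {fromℕ (diam d (lcaCluster T x y))} {u x y}
    (fromℕ-mono-≤ {label d T x y} {diam d (lcaCluster T x y)} (label-≤-diam d T x y))
    (diam-elim d (λ k → fromℕ k ≤ℝ u x y) (lcaCluster T x y) (nonNegative {x} {y})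
      λ {a} {b} a∈ b∈ → ≤ℝ-trans {fromℕ (d a b)} {u a b} {u x y} (dominates a b)
        (grown-lcaCluster T-grown (full x) (full y) xy a∈ b∈))

  weightedSum-≤ : weightedSum G (diamLabel (dist G connected) T) ≤ℝ weightedSum G u
  weightedSum-≤ = sumℝ-map-mono-≤ {f = λ (x , y) → weight x y *ℝ diamLabel (dist G connected) T x y}
    {g = λ (x , y) → weight x y *ℝ u x y} (edges G) λ {(x , y)} e∈ →
      let xy = ∈-edges⇒adj G e∈
      in *ℝ-monoˡ-≤-pos {weight x y} {diamLabel d T x y} {u x y} (weight-pos xy) (edge-≤ x y xy)
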